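{- Let $p,t$ be integers with $1<t<p$, and let $\Gamma^{\{t\}}$ be the graph whose vertices are the $t$-element subsets of $\{1,\dots,p\}$, two distinct vertices being adjacent if and only if they have non-empty intersection. If $p\ge 2t$, then $$S_1(\Gamma^{\{t\}})=\binom{p}{t}\left(\binom{p}{t}-\binom{p-t}{t}-1\right)\left(\binom{p}{t}+\binom{p-t}{t}-1\right),$$ $$S_2(\Gamma^{\{t\}})=\frac12\binom{p}{t}\left(\binom{p}{t}-\binom{p-t}{t}-1\right)\left(\binom{p}{t}+\binom{p-t}{t}-1\right)^2,$$ $$\overline{S_1}(\Gamma^{\{t\}})=\binom{p-t}{t}\binom{p}{t}\left(\binom{p}{t}+\binom{p-t}{t}-1\right),$$ $$\overline{S_2}(\Gamma^{\{t\}})=\left(\binom{\binom{p}{t}}{2}-\frac12\binom{p}{t}\left(\binom{p}{t}-\binom{p-t}{t}-1\right)\right)\left(\binom{p}{t}+\binom{p-t}{t}-1\right)^2.$$ If $p<2t$, then $$S_1(\Gamma^{\{t\}})=\binom{p}{t}\left(\binom{p}{t}-1\right)^2,\qquad S_2(\Gamma^{\{t\}})=\frac12\binom{p}{t}\left(\binom{p}{t}-1\right)^3,$$ $$\overline{S_1}(\Gamma^{\{t\}})=2\binom{\binom{p}{t}}{2}\left(\binom{p}{t}-1\right)-\binom{p}{t}\left(\binom{p}{t}-1\right)^2,$$ $$\overline{S_2}(\Gamma^{\{t\}})=\left(\binom{\binom{p}{t}}{2}-\frac12\binom{p}{t}\left(\binom{p}{t}-1\right)\right)\left(\binom{p}{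t}-1\right)^2.$$
   Context: For a finite connected simple graph $G$, $d_G(u,v)$ is the shortest-path distance and $\sigma_G(u)=\sum_{v\in V(G)}d_G(u,v)$ is the status of $u$. The status connectivity indices are $S_1(G)=\sum_{uv\in E(G)}[\sigma_G(u)+\sigma_G(v)]$ and $S_2(G)=\sum_{uv\in E(G)}\sigma_G(u)\sigma_G(v)$. The status co-indices are $\overline{S_1}(G)=\sum_{uv\notin E(G)}[\sigma_G(u)+\sigma_G(v)]$ and $\overline{S_2}(G)=\sum_{uv\notin E(G)}\sigma_G(u)\sigma_G(v)$, where the sums over $uv\notin E(G)$ range over unordered pairs of distinct non-adjacent vertices. -}

module Defs where

open import Data.Bool.Properties as Bool using ()
open import Data.Fin.Subset
  using (Subset; inside; outside; ∣_∣; _∩_; _∪_; _⊆_; _∈_; ⁅_⁆; ⊤; Nonempty)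
open import Data.Fin.Subset.Properties
  using ( nonempty?; ∩-comm; ∣⁅x⁆∣≡1; ∣⊤∣≡n; ∣⊥∣≡0; Empty-unique; ⊆-max
        ; x∈p∩q⁺; x∈⁅x⁆; p⊆p∪q; q⊆p∪q; out⊆; in⊆in)
import Data.Integer.Base as ℤ
open import Data.List.Base using (List; []; _∷_; _++_; map; filter)
open import Data.List.Membership.Propositional using (find; lose)
  renaming (_∈_ to _∈ˡ_)
open import Data.List.Membership.Propositional.Properties
  using (∈-map⁺; ∈-map⁻; ∈-++⁺ˡ; ∈-++⁺ʳ)
open import Data.List.Relation.Unary.All using ([])
open import Data.List.Relation.Unary.AllPairs using ([]; _∷_)
open import Data.List.Relation.Unary.Any using (here; any?)
open import Data.List.Relation.Unary.Enumerates.Setoid using (IsEnumeration)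
open import Data.List.Relation.Unary.Unique.Propositional using (Unique)
import Data.List.Relation.Unary.Unique.Propositional.Properties as Unique
open import Data.Nat.Base
  using (ℕ; zero; suc; _+_; _*_; _≤_; _<_; z≤n; s≤s; s≤s⁻¹)
open import Data.Nat.ListAction using (sum)
import Data.Nat.Properties as ℕ
open import Data.Product.Base using (Σ; ∃; ∃-syntax; _×_; _,_; proj₁; proj₂)
open import Data.Product.Properties using (≡-dec)
open import Data.Rational.Base using (ℚ; _/_)
open import Data.Vec.Base using ([]; _∷_)
import Data.Vec.Properties as Vec
open import Function.Base using (_∘_)
open import Relation.Binary.Definitions
  using (Decidable; DecidableEquality; Irreflexive; Symmetric)
open import Relation.Binary.PropositionalEquality
  using (_≡_; _≢_; refl; sym; trans; cong; cong₂; subst; setoid)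
open import Relation.Nullary using (¬_; yes; no; contradiction)
open import Relation.Nullary.Decidable using (map′; ¬?; _×-dec_)
import Relation.Unary as U

data Walk {V : Set} (Adj : V → V → Set) : V → V → ℕ → Set where
  []  : ∀ {u} → Walk Adj u u 0
  _∷_ : ∀ {u v w n} → Adj u v → Walk Adj v w n → Walk Adj u w (suc n)

record ConnectedGraph : Set₁ where
  field
    V         : Set
    vertices  : List V
    complete  : IsEnumeration (setoid V) vertices
    unique    : Unique vertices
    Adj       : V → V → Set
    adj?      : Decidable Adj
    symmetric : Symmetric Adj
    loopless  : Irreflexive _≡_ Adj
    connected : ∀ u v → ∃[ n ] Walk Adj u v n
    _≟_       : DecidableEquality V

-- For a duplicate-free list, every two-element subset {x , y} of its entries
-- is listed exactly once, in one of its two orders.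
pairs : {A : Set} → List A → List (A × A)
pairs []       = []
pairs (x ∷ xs) = map (x ,_) xs ++ pairs xs

least : {P : ℕ → Set} → U.Decidable P → ∀ n → P n →
        ∃[ m ] P m × (∀ k → P k → m ≤ k)
least P? n Pn with P? 0
least P? n       Pn | yes P0 = 0 , P0 , λ _ _ → z≤n
least P? zero    Pn | no ¬P0 = contradiction Pn ¬P0
least {P} P? (suc n) Pn | no ¬P0
  with m , Pm , min ← least {P ∘ suc} (P? ∘ suc) n Pn = suc m , Pm , min′
  where
  min′ : ∀ k → P k → suc m ≤ k
  min′ zero    P0 = contradiction P0 ¬P0
  min′ (suc k) Pk = s≤s (min k Pk)

module _ (G : ConnectedGraph) where
  open ConnectedGraph G

  walk? : ∀ u v → U.Decidable (Walk Adj u v)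
  walk? u v zero    = map′ (λ { refl → [] }) (λ { [] → refl }) (u ≟ v)
  walk? u v (suc n) = map′
    (λ a → let _ , _ , (e , w) = find {P = λ x → Adj u x × Walk Adj x v n} a in e ∷ w)
    (λ { (e ∷ w) → lose (complete _) (e , w) })
    (any? (λ x → adj? u x ×-dec walk? x v n) vertices)

  -- A walk of minimal length is a path, so minimising over walks gives the
  -- shortest-path distance.
  shortest : ∀ u v → ∃[ d ] Walk Adj u v d × (∀ n → Walk Adj u v n → d ≤ n)
  shortest u v = let n , w = connected u v in least (walk? u v) n w

  dist : V → V → ℕ
  dist u v = proj₁ (shortest u v)

  status : V → ℕ
  status u = sum (map (dist u) vertices)

  edges nonEdges : List (V × V)
  edges    = filter (λ (u , v) → adj? u v) (pairs vertices)
  nonEdges = filter (λ (u , v) → ¬? (adj? u v)) (pairs vertices)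

  S₁ S₂ coS₁ coS₂ : ℕ
  S₁   = sum (map (λ (u , v) → status u + status v) edges)
  S₂   = sum (map (λ (u , v) → status u * status v) edges)
  coS₁ = sum (map (λ (u , v) → status u + status v) nonEdges)
  coS₂ = sum (map (λ (u , v) → status u * status v) nonEdges)

TSubset : ℕ → ℕ → Set
TSubset p t = Σ (Subset p) λ A → ∣ A ∣ ≡ t

module _ {p t : ℕ} where

  TSubset-≡ : {A B : TSubset p t} → proj₁ A ≡ proj₁ B → A ≡ B
  TSubset-≡ {A , _} refl = cong (A ,_) (ℕ.≡-irrelevant _ _)

  _≟ᵀ_ : DecidableEquality (TSubset p t)
  _≟ᵀ_ = ≡-dec (Vec.≡-dec Bool._≟_) λ _ _ → yes (ℕ.≡-irrelevant _ _)

  Meets : TSubset p t → TSubset p t → Set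
  Meets A B = A ≢ B × Nonempty (proj₁ A ∩ proj₁ B)

  meets? : Decidable Meets
  meets? A B = ¬? (A ≟ᵀ B) ×-dec nonempty? (proj₁ A ∩ proj₁ B)

  Meets-sym : Symmetric Meets
  Meets-sym {A} {B} (A≢B , ne) =
    A≢B ∘ sym , subst Nonempty (∩-comm (proj₁ A) (proj₁ B)) ne

addIn : ∀ {p t} → TSubset p t → TSubset (suc p) (suc t)
addIn (A , eq) = inside ∷ A , cong suc eq

addOut : ∀ {p t} → TSubset p t → TSubset (suc p) t
addOut (A , eq) = outside ∷ A , eq

addIn-injective : ∀ {p t} {A B : TSubset p t} → addIn A ≡ addIn B → A ≡ B
addIn-injective eq = TSubset-≡ (Vec.∷-injectiveʳ (cong proj₁ eq))

addOut-injective : ∀ {p t} {A B : TSubset p t} → addOut A ≡ addOut B → A ≡ B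
addOut-injective eq = TSubset-≡ (Vec.∷-injectiveʳ (cong proj₁ eq))

tSubsets : ∀ p t → List (TSubset p t)
tSubsets zero    zero    = ([] , refl) ∷ []
tSubsets zero    (suc t) = []
tSubsets (suc p) zero    = map addOut (tSubsets p zero)
tSubsets (suc p) (suc t) =
  map addIn (tSubsets p t) ++ map addOut (tSubsets p (suc t))

tSubsets-complete : ∀ p t → IsEnumeration (setoid (TSubset p t)) (tSubsets p t)
tSubsets-complete zero    zero    ([] , refl) = here refl
tSubsets-complete (suc p) zero    (outside ∷ A , eq) =
  ∈-map⁺ addOut (tSubsets-complete p zero (A , eq))
tSubsets-complete (suc p) (suc t) (outside ∷ A , eq) =
  ∈-++⁺ʳ (map addIn (tSubsets p t))
    (∈-map⁺ addOut (tSubsets-complete p (suc t) (A , eq)))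
tSubsets-complete (suc p) (suc t) (inside ∷ A , refl) =
  ∈-++⁺ˡ (∈-map⁺ addIn (tSubsets-complete p t (A , refl)))

tSubsets-unique : ∀ p t → Unique (tSubsets p t)
tSubsets-unique zero    zero    = [] ∷ []
tSubsets-unique zero    (suc t) = []
tSubsets-unique (suc p) zero    =
  Unique.map⁺ addOut-injective (tSubsets-unique p zero)
tSubsets-unique (suc p) (suc t) = Unique.++⁺
  (Unique.map⁺ addIn-injective (tSubsets-unique p t))
  (Unique.map⁺ addOut-injective (tSubsets-unique p (suc t)))
  λ (i , o) → disjoint (∈-map⁻ addIn i) (∈-map⁻ addOut o)
  where
  disjoint : ∀ {C} → ∃[ A ] A ∈ˡ tSubsets p t × C ≡ addIn A →
             ¬ (∃[ B ] B ∈ˡ tSubsets p (suc t) × C ≡ addOut B)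
  disjoint (_ , _ , refl) (_ , _ , ())

enlarge : ∀ {p t} (A : Subset p) → ∣ A ∣ ≤ t → t ≤ p →
          Σ (TSubset p t) λ B → A ⊆ proj₁ B
enlarge [] _ z≤n = ([] , refl) , λ ()
enlarge (inside ∷ A) (s≤s A≤t) (s≤s t≤p)
  with B , A⊆B ← enlarge A A≤t t≤p = addIn B , in⊆in A⊆B
enlarge {suc p} {t} (outside ∷ A) A≤t t≤1+p with t ℕ.≤? p
... | yes t≤p with B , A⊆B ← enlarge A A≤t t≤p = addOut B , out⊆ A⊆B
... | no t≰p =
  (⊤ , trans (∣⊤∣≡n (suc p)) (ℕ.≤-antisym (ℕ.≰⇒> t≰p) t≤1+p)) , ⊆-max _

∣p∪q∣≤∣p∣+∣q∣ : ∀ {n} (p q : Subset n) → ∣ p ∪ q ∣ ≤ ∣ p ∣ + ∣ q ∣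
∣p∪q∣≤∣p∣+∣q∣ []            []            = z≤n
∣p∪q∣≤∣p∣+∣q∣ (outside ∷ p) (outside ∷ q) = ∣p∪q∣≤∣p∣+∣q∣ p q
∣p∪q∣≤∣p∣+∣q∣ (outside ∷ p) (inside  ∷ q) =
  subst (suc ∣ p ∪ q ∣ ≤_) (sym (ℕ.+-suc ∣ p ∣ ∣ q ∣)) (s≤s (∣p∪q∣≤∣p∣+∣q∣ p q))
∣p∪q∣≤∣p∣+∣q∣ (inside  ∷ p) (outside ∷ q) = s≤s (∣p∪q∣≤∣p∣+∣q∣ p q)
∣p∪q∣≤∣p∣+∣q∣ (inside  ∷ p) (inside  ∷ q) =
  s≤s (ℕ.≤-trans (∣p∪q∣≤∣p∣+∣q∣ p q) (ℕ.+-monoʳ-≤ ∣ p ∣ (ℕ.n≤1+n _)))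

TSubset-nonempty : ∀ {p t} → 0 < t → (A : TSubset p t) → Nonempty (proj₁ A)
TSubset-nonempty {p} 0<t (A , refl) with nonempty? A
... | yes ne = ne
... | no  em = contradiction
  (trans (cong ∣_∣ (Empty-unique em)) (∣⊥∣≡0 p)) (ℕ.>⇒≢ 0<t)

Meets-connected : ∀ {p t} → 1 < t → t ≤ p → (A B : TSubset p t) →
                  ∃[ n ] Walk Meets A B n
Meets-connected {p} {t} 1<t t≤p A B with A ≟ᵀ B | nonempty? (proj₁ A ∩ proj₁ B)
... | yes refl | _      = 0 , []
... | no A≢B   | yes ne = 1 , (A≢B , ne) ∷ []
... | no A≢B   | no em  = 2 , A~C ∷ C~B ∷ []
  where
  0<t = ℕ.<⇒≤ 1<t
  a = proj₁ (TSubset-nonempty 0<t A)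
  b = proj₁ (TSubset-nonempty 0<t B)
  a∈A = proj₂ (TSubset-nonempty 0<t A)
  b∈B = proj₂ (TSubset-nonempty 0<t B)
  ab : Subset p
  ab = ⁅ a ⁆ ∪ ⁅ b ⁆
  ab≤t : ∣ ab ∣ ≤ t
  ab≤t = ℕ.≤-trans (∣p∪q∣≤∣p∣+∣q∣ ⁅ a ⁆ ⁅ b ⁆)
    (subst (_≤ t) (sym (cong₂ _+_ (∣⁅x⁆∣≡1 a) (∣⁅x⁆∣≡1 b))) 1<t)
  C : TSubset p t
  C = proj₁ (enlarge ab ab≤t t≤p)
  ab⊆C : ab ⊆ proj₁ C
  ab⊆C = proj₂ (enlarge ab ab≤t t≤p)
  a∈C : a ∈ proj₁ C
  a∈C = ab⊆C (p⊆p∪q ⁅ b ⁆ (x∈⁅x⁆ a))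
  b∈C : b ∈ proj₁ C
  b∈C = ab⊆C (q⊆p∪q ⁅ a ⁆ ⁅ b ⁆ (x∈⁅x⁆ b))
  A~C : Meets A C
  A~C = (λ A≡C → em (b , x∈p∩q⁺ (subst (λ X → b ∈ proj₁ X) (sym A≡C) b∈C , b∈B)))
      , (a , x∈p∩q⁺ (a∈A , a∈C))
  C~B : Meets C B
  C~B = (λ C≡B → em (a , x∈p∩q⁺ (a∈A , subst (λ X → a ∈ proj₁ X) C≡B a∈C)))
      , (b , x∈p∩q⁺ (b∈C , b∈B))

-- The ground set {1,…,p} is represented by Fin p.
Γ : ∀ p t → 1 < t → t < p → ConnectedGraph
Γ p t 1<t t<p = record
  { V         = TSubset p t
  ; vertices  = tSubsets p t
  ; complete  = tSubsets-complete p t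
  ; unique    = tSubsets-unique p t
  ; Adj       = Meets
  ; adj?      = meets?
  ; symmetric = Meets-sym
  ; loopless  = λ A≡B A~B → proj₁ A~B A≡B
  ; connected = Meets-connected 1<t (ℕ.<⇒≤ t<p)
  ; _≟_       = _≟ᵀ_
  }

fromℕ : ℕ → ℚ
fromℕ n = ℤ.+ n / 1

{-# OPTIONS --safe #-}
-- Any two t-subsets lie within distance 2, so the status of a vertex is
-- determined by its degree: with N vertices, status + degree = 2 (N - 1).
-- A t-subset is disjoint from M = C(p - t, t) others, so all degrees are
-- N - M - 1 and all statuses N + M - 1, and the four indices only depend on the
-- numbers of edges and of non-edges.  For p < 2t the same holds with M = 0.
module Submission where

open import Defs
open import Data.Rational.Base using (½; 1ℚ; _+_; _-_; _*_)
open import Algebra.Definitions.RawSemiring Data.Rational.Base.+-*-rawSemiring using (_^_)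
open import Data.Nat.Base as ℕ using (ℕ)
open import Data.Nat.Combinatorics using (_C_)
open import Data.Product.Base using (_×_)
open import Relation.Binary.PropositionalEquality using (_≡_)

open import Data.Fin.Base using (zero; suc)
open import Data.Fin.Subset using (Subset; inside; outside; ∣_∣; _∩_; ⊥; Nonempty)
open import Data.Fin.Subset.Properties using (nonempty?; ∣p∣≤n; ∣⊥∣≡0; drop-there; ∩-idem)
import Data.Integer.Base as ℤ
import Data.Integer.Properties as ℤ
open import Data.List.Base using (List; []; _∷_; _++_; map; filter; length)
open import Data.List.Membership.Propositional using () renaming (_∈_ to _∈ˡ_)
open import Data.List.Properties using (map-++; map-∘; map-cong; length-++; length-map)
open import Data.List.Relation.Unary.All as All using (All; []; _∷_)
open import Data.List.Relation.Unary.AllPairs using ([]; _∷_)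
open import Data.List.Relation.Unary.Any using (here; there)
open import Data.List.Relation.Unary.Unique.Propositional using (Unique)
open import Data.Nat.Combinatorics using (nCk+nC[k+1]≡[n+1]C[k+1]; nC1≡n; k>n⇒nCk≡0)
open import Data.Nat.ListAction using (sum)
open import Data.Nat.ListAction.Properties using (sum-++)
import Data.Nat.Properties as ℕ
open import Data.Nat.Tactic.RingSolver using (solve-∀)
open import Data.Product.Base using (_,_; proj₁; proj₂; uncurry)
open import Data.Rational.Base using (ℚ; 0ℚ; toℚᵘ)
import Data.Rational.Properties as ℚ
open import Data.Rational.Solver using (module +-*-Solver)
import Data.Rational.Unnormalised.Base as ℚᵘ
import Data.Rational.Unnormalised.Properties as ℚᵘ
open import Data.Vec.Base using ([]; _∷_; here; there)
open import Function.Base using (_∘_; const)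
open import Relation.Binary.Definitions using (DecidableEquality)
open import Relation.Binary.PropositionalEquality
  using (_≢_; refl; sym; trans; cong; cong₂; subst; module ≡-Reasoning)
open import Relation.Nullary using (¬_; Dec; yes; no; contradiction)
open import Relation.Nullary.Decidable using (¬?)
open import Relation.Unary using (Decidable)

private
  variable
    A B P Q : Set

-- Finite sums over lists and unordered pairs

∑ : List A → (A → ℕ) → ℕ
∑ xs f = sum (map f xs)

∑-++ : ∀ (xs ys : List A) f → ∑ (xs ++ ys) f ≡ ∑ xs f ℕ.+ ∑ ys f
∑-++ xs ys f = trans (cong sum (map-++ f xs ys)) (sum-++ (map f xs) (map f ys))

∑-map : ∀ (g : A → B) xs f → ∑ (map g xs) f ≡ ∑ xs (f ∘ g)
∑-map g xs f = cong sum (sym (map-∘ xs))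

∑-cong : ∀ (xs : List A) {f g : A → ℕ} → (∀ x → f x ≡ g x) → ∑ xs f ≡ ∑ xs g
∑-cong xs f≗g = cong sum (map-cong f≗g xs)

∑-+ : ∀ (xs : List A) f g → ∑ xs (λ x → f x ℕ.+ g x) ≡ ∑ xs f ℕ.+ ∑ xs g
∑-+ []       f g = refl
∑-+ (x ∷ xs) f g =
  trans (cong ((f x ℕ.+ g x) ℕ.+_) (∑-+ xs f g))
        (interchange (f x) (g x) (∑ xs f) (∑ xs g))
  where
  interchange : ∀ a b c d → (a ℕ.+ b) ℕ.+ (c ℕ.+ d) ≡ (a ℕ.+ c) ℕ.+ (b ℕ.+ d)
  interchange = solve-∀

∑-const : ∀ (xs : List A) c → ∑ xs (const c) ≡ length xs ℕ.* c
∑-const []       c = refl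
∑-const (x ∷ xs) c = cong (c ℕ.+_) (∑-const xs c)

∑-constant : ∀ (xs : List A) {f c} → (∀ x → f x ≡ c) → ∑ xs f ≡ length xs ℕ.* c
∑-constant xs f≡c = trans (∑-cong xs f≡c) (∑-const xs _)

∑-*2 : ∀ (xs : List A) f → ∑ xs (λ x → 2 ℕ.* f x) ≡ 2 ℕ.* ∑ xs f
∑-*2 xs f = trans (∑-+ xs f (λ x → f x ℕ.+ 0))
  (cong (∑ xs f ℕ.+_) (trans (∑-cong xs (λ x → ℕ.+-identityʳ (f x))) (sym (ℕ.+-identityʳ _))))

-- The square of index pairs splits into its diagonal and two triangles, which carry equal sums by
-- symmetry of `f`. The induction peels off the first row and the first column, both equal to `row`
-- away from the corner.
∑∑-symmetric : ∀ (f : A → A → ℕ) → (∀ x y → f x y ≡ f y x) → ∀ xs →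
               ∑ xs (λ x → ∑ xs (f x)) ≡
               ∑ xs (λ x → f x x) ℕ.+ 2 ℕ.* ∑ (pairs xs) (uncurry f)
∑∑-symmetric f f-sym []       = refl
∑∑-symmetric f f-sym (x ∷ xs) = begin
  (f x x ℕ.+ row) ℕ.+ ∑ xs (λ y → f y x ℕ.+ ∑ xs (f y))
    ≡⟨ cong ((f x x ℕ.+ row) ℕ.+_) (∑-+ xs (λ y → f y x) (λ y → ∑ xs (f y))) ⟩
  (f x x ℕ.+ row) ℕ.+ (∑ xs (λ y → f y x) ℕ.+ ∑ xs (λ y → ∑ xs (f y)))
    ≡⟨ cong ((f x x ℕ.+ row) ℕ.+_)
         (cong₂ ℕ._+_ (∑-cong xs (λ y → f-sym y x)) (∑∑-symmetric f f-sym xs)) ⟩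
  (f x x ℕ.+ row) ℕ.+ (row ℕ.+ (diagonal ℕ.+ 2 ℕ.* rest))
    ≡⟨ rearrange (f x x) row diagonal rest ⟩
  (f x x ℕ.+ diagonal) ℕ.+ 2 ℕ.* (row ℕ.+ rest)
    ≡⟨ cong (λ n → (f x x ℕ.+ diagonal) ℕ.+ 2 ℕ.* n) (sym
         (trans (∑-++ (map (x ,_) xs) (pairs xs) (uncurry f))
                (cong (ℕ._+ rest) (∑-map (x ,_) xs (uncurry f))))) ⟩
  (f x x ℕ.+ diagonal) ℕ.+ 2 ℕ.* ∑ (pairs (x ∷ xs)) (uncurry f) ∎
  where
  open ≡-Reasoning
  row = ∑ xs (f x)
  diagonal = ∑ xs (λ y → f y y)
  rest = ∑ (pairs xs) (uncurry f)
  rearrange : ∀ a b c d →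
    (a ℕ.+ b) ℕ.+ (b ℕ.+ (c ℕ.+ 2 ℕ.* d)) ≡ (a ℕ.+ c) ℕ.+ 2 ℕ.* (b ℕ.+ d)
  rearrange = solve-∀

-- Pascal's rule: `length xs C 1` of the pairs contain the head, and `length xs C 2` do not.
length-pairs : ∀ (xs : List A) → length (pairs xs) ≡ length xs C 2
length-pairs []       = refl
length-pairs (x ∷ xs) = begin
  length (map (x ,_) xs ++ pairs xs)          ≡⟨ length-++ (map (x ,_) xs) ⟩
  length (map (x ,_) xs) ℕ.+ length (pairs xs)
    ≡⟨ cong₂ ℕ._+_ (trans (length-map (x ,_) xs) (sym (nC1≡n _))) (length-pairs xs) ⟩
  length xs C 1 ℕ.+ length xs C 2             ≡⟨ nCk+nC[k+1]≡[n+1]C[k+1] (length xs) 1 ⟩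
  ℕ.suc (length xs) C 2                       ∎
  where open ≡-Reasoning

-- A form of C(n,2) = n(n-1)/2 free of division and subtraction, so that it carries over to ℚ
-- directly.
n+2*nC2≡n*n : ∀ n → n ℕ.+ 2 ℕ.* (n C 2) ≡ n ℕ.* n
n+2*nC2≡n*n ℕ.zero    = refl
n+2*nC2≡n*n (ℕ.suc n) = begin
  ℕ.suc n ℕ.+ 2 ℕ.* (ℕ.suc n C 2)
    ≡⟨ cong (λ k → ℕ.suc n ℕ.+ 2 ℕ.* k) (sym (nCk+nC[k+1]≡[n+1]C[k+1] n 1)) ⟩
  ℕ.suc n ℕ.+ 2 ℕ.* (n C 1 ℕ.+ n C 2)
    ≡⟨ cong (λ k → ℕ.suc n ℕ.+ 2 ℕ.* (k ℕ.+ n C 2)) (nC1≡n n) ⟩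
  ℕ.suc n ℕ.+ 2 ℕ.* (n ℕ.+ n C 2)
    ≡⟨ rearrange n (n C 2) ⟩
  (n ℕ.+ 2 ℕ.* (n C 2)) ℕ.+ (1 ℕ.+ 2 ℕ.* n)
    ≡⟨ cong (ℕ._+ (1 ℕ.+ 2 ℕ.* n)) (n+2*nC2≡n*n n) ⟩
  n ℕ.* n ℕ.+ (1 ℕ.+ 2 ℕ.* n)
    ≡⟨ square n ⟩
  ℕ.suc n ℕ.* ℕ.suc n ∎
  where
  open ≡-Reasoning
  rearrange : ∀ n k → ℕ.suc n ℕ.+ 2 ℕ.* (n ℕ.+ k) ≡ (n ℕ.+ 2 ℕ.* k) ℕ.+ (1 ℕ.+ 2 ℕ.* n)
  rearrange = solve-∀
  square : ∀ n → n ℕ.* n ℕ.+ (1 ℕ.+ 2 ℕ.* n) ≡ ℕ.suc n ℕ.* ℕ.suc n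
  square = solve-∀

-- Indicators of decisions and counting with them

χ : Dec P → ℕ
χ (yes _) = 1
χ (no  _) = 0

χ-yes : (P? : Dec P) → P → χ P? ≡ 1
χ-yes (yes _) _ = refl
χ-yes (no ¬p) p = contradiction p ¬p

χ-no : (P? : Dec P) → ¬ P → χ P? ≡ 0
χ-no (yes p) ¬p = contradiction p ¬p
χ-no (no _)  _  = refl

χ-⇔ : (P? : Dec P) (Q? : Dec Q) → (P → Q) → (Q → P) → χ P? ≡ χ Q?
χ-⇔ P? (yes q) _ Q⇒P = χ-yes P? (Q⇒P q)
χ-⇔ P? (no ¬q) P⇒Q _ = χ-no P? (¬q ∘ P⇒Q)

length-filter-χ : ∀ {P : A → Set} (P? : Decidable P) xs →
                  length (filter P? xs) ≡ ∑ xs (χ ∘ P?)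
length-filter-χ P? []       = refl
length-filter-χ P? (x ∷ xs) with P? x
... | yes _ = cong ℕ.suc (length-filter-χ P? xs)
... | no  _ = length-filter-χ P? xs

length-filter-¬ : ∀ {P : A → Set} (P? : Decidable P) xs →
                  length (filter P? xs) ℕ.+ length (filter (¬? ∘ P?) xs) ≡ length xs
length-filter-¬ P? []       = refl
length-filter-¬ P? (x ∷ xs) with P? x
... | yes _ = cong ℕ.suc (length-filter-¬ P? xs)
... | no  _ = trans (ℕ.+-suc _ _) (cong ℕ.suc (length-filter-¬ P? xs))

∑-χ-∉ : ∀ (_≟_ : DecidableEquality A) {x xs} → All (x ≢_) xs → ∑ xs (χ ∘ (x ≟_)) ≡ 0
∑-χ-∉ _≟_ []                   = refl
∑-χ-∉ _≟_ {x} (_∷_ {y} x≢y ps) = cong₂ ℕ._+_ (χ-no (x ≟ y) x≢y) (∑-χ-∉ _≟_ ps)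

-- Membership provides one occurrence of `x`, and uniqueness excludes a second. In the sums over
-- vertices this is the contribution of the vertex itself.
∑-χ-≟ : ∀ (_≟_ : DecidableEquality A) {x xs} → Unique xs → x ∈ˡ xs →
        ∑ xs (χ ∘ (x ≟_)) ≡ 1
∑-χ-≟ _≟_ {x} (x∉xs ∷ _) (here refl) = cong₂ ℕ._+_ (χ-yes (x ≟ x) refl) (∑-χ-∉ _≟_ x∉xs)
∑-χ-≟ _≟_ {x} (y∉xs ∷ unique) (there {y} x∈xs) =
  cong₂ ℕ._+_ (χ-no (x ≟ y) (λ x≡y → All.lookup y∉xs x∈xs (sym x≡y))) (∑-χ-≟ _≟_ unique x∈xs)

-- Degrees, edge counts and statuses in graphs of diameter at most 2

module _ (G : ConnectedGraph) where
  open ConnectedGraph G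

  private
    order = length vertices

  degree : V → ℕ
  degree u = ∑ vertices (χ ∘ adj? u)

  -- The adjacency indicator is symmetric and vanishes on the diagonal, so only the doubled sum over
  -- unordered pairs survives.
  handshake : ∑ vertices degree ≡ 2 ℕ.* length (edges G)
  handshake = begin
    ∑ vertices degree
      ≡⟨ ∑∑-symmetric (λ u v → χ (adj? u v))
           (λ u v → χ-⇔ (adj? u v) (adj? v u) symmetric symmetric) vertices ⟩
    ∑ vertices (λ u → χ (adj? u u)) ℕ.+ 2 ℕ.* ∑ (pairs vertices) (λ (u , v) → χ (adj? u v))
      ≡⟨ cong (ℕ._+ 2 ℕ.* ∑ (pairs vertices) (λ (u , v) → χ (adj? u v)))
           (trans (∑-constant vertices λ u → χ-no (adj? u u) (loopless refl))
                              (ℕ.*-zeroʳ order)) ⟩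
    2 ℕ.* ∑ (pairs vertices) (λ (u , v) → χ (adj? u v))
      ≡⟨ cong (2 ℕ.*_) (sym (length-filter-χ (λ (u , v) → adj? u v) (pairs vertices))) ⟩
    2 ℕ.* length (edges G) ∎
    where open ≡-Reasoning

  ∣edges∣+∣nonEdges∣ : length (edges G) ℕ.+ length (nonEdges G) ≡ order C 2
  ∣edges∣+∣nonEdges∣ =
    trans (length-filter-¬ (λ (u , v) → adj? u v) (pairs vertices)) (length-pairs vertices)

  dist-≤ : ∀ {u v n} → Walk Adj u v n → dist G u v ℕ.≤ n
  dist-≤ {u} {v} w = proj₂ (proj₂ (shortest G u v)) _ w

  module _ (diameter≤2 : ∀ u v → dist G u v ℕ.≤ 2) where

    -- Distances 0, 1 and 2 mean equal, adjacent and neither. The bracket is the amount by which the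
    -- distance falls short of 2 in each case.
    dist+χ : ∀ u v → dist G u v ℕ.+ (2 ℕ.* χ (u ≟ v) ℕ.+ χ (adj? u v)) ≡ 2
    dist+χ u v with shortest G u v | diameter≤2 u v
    ... | 0 , [] , _ | _ = cong₂ (λ a b → 2 ℕ.* a ℕ.+ b)
      (χ-yes (u ≟ u) refl) (χ-no (adj? u u) (loopless refl))
    ... | 1 , e ∷ [] , _ | _ = cong₂ (λ a b → 1 ℕ.+ (2 ℕ.* a ℕ.+ b))
      (χ-no (u ≟ v) (λ u≡v → loopless u≡v e)) (χ-yes (adj? u v) e)
    -- Equality would give a walk of length 0 and adjacency one of length 1, both against the
    -- minimality of 2.
    ... | 2 , _ , minimal | _ = cong₂ (λ a b → 2 ℕ.+ (2 ℕ.* a ℕ.+ b))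
      (χ-no (u ≟ v) λ { refl → contradiction (minimal 0 []) λ () })
      (χ-no (adj? u v) λ e → contradiction (minimal 1 (e ∷ [])) λ { (ℕ.s≤s ()) })
    ... | ℕ.suc (ℕ.suc (ℕ.suc _)) , _ | ℕ.s≤s (ℕ.s≤s ())

    -- Summing `dist+χ` over all `v`: the vertex `u` itself accounts for the 2, its neighbours for
    -- the degree. The additive form avoids truncated subtraction.
    status+degree : ∀ u → status G u ℕ.+ (2 ℕ.+ degree u) ≡ order ℕ.* 2
    status+degree u = begin
      status G u ℕ.+ (2 ℕ.+ degree u)
        ≡⟨ cong (λ n → status G u ℕ.+ (2 ℕ.* n ℕ.+ degree u))
             (sym (∑-χ-≟ _≟_ unique (complete u))) ⟩
      status G u ℕ.+ (2 ℕ.* ∑ vertices (χ ∘ (u ≟_)) ℕ.+ degree u)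
        ≡⟨ cong (λ n → status G u ℕ.+ (n ℕ.+ degree u)) (sym (∑-*2 vertices (χ ∘ (u ≟_)))) ⟩
      status G u ℕ.+ (∑ vertices (λ v → 2 ℕ.* χ (u ≟ v)) ℕ.+ degree u)
        ≡⟨ cong (status G u ℕ.+_) (sym (∑-+ vertices _ _)) ⟩
      status G u ℕ.+ ∑ vertices (λ v → 2 ℕ.* χ (u ≟ v) ℕ.+ χ (adj? u v))
        ≡⟨ sym (∑-+ vertices _ _) ⟩
      ∑ vertices (λ v → dist G u v ℕ.+ (2 ℕ.* χ (u ≟ v) ℕ.+ χ (adj? u v)))
        ≡⟨ ∑-constant vertices (dist+χ u) ⟩
      order ℕ.* 2 ∎
      where open ≡-Reasoning

-- Counting t-subsets, and those disjoint from a given set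

length-tSubsets : ∀ p t → length (tSubsets p t) ≡ p C t
length-tSubsets ℕ.zero    ℕ.zero    = refl
length-tSubsets ℕ.zero    (ℕ.suc t) = sym (k>n⇒nCk≡0 {k = ℕ.suc t} ℕ.z<s)
length-tSubsets (ℕ.suc p) ℕ.zero    =
  trans (length-map addOut (tSubsets p 0)) (length-tSubsets p 0)
length-tSubsets (ℕ.suc p) (ℕ.suc t) = begin
  length (map addIn (tSubsets p t) ++ map addOut (tSubsets p (ℕ.suc t)))
    ≡⟨ length-++ (map addIn (tSubsets p t)) ⟩
  length (map addIn (tSubsets p t)) ℕ.+ length (map addOut (tSubsets p (ℕ.suc t)))
    ≡⟨ cong₂ ℕ._+_ (trans (length-map addIn (tSubsets p t)) (length-tSubsets p t))
                   (trans (length-map addOut (tSubsets p (ℕ.suc t))) (length-tSubsets p (ℕ.suc t))) ⟩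
  -- The recursion of `tSubsets`, by whether the first point belongs to the set, is Pascal's rule.
  p C t ℕ.+ p C ℕ.suc t
    ≡⟨ nCk+nC[k+1]≡[n+1]C[k+1] p t ⟩
  ℕ.suc p C ℕ.suc t ∎
  where open ≡-Reasoning

χ-empty-outside : ∀ {n} (Z : Subset n) →
  χ (¬? (nonempty? (outside ∷ Z))) ≡ χ (¬? (nonempty? Z))
χ-empty-outside Z = χ-⇔ (¬? (nonempty? (outside ∷ Z))) (¬? (nonempty? Z))
  (λ empty (i , i∈Z) → empty (suc i , there i∈Z))
  (λ { empty (suc i , there i∈Z) → empty (i , i∈Z) })

χ-empty-inside : ∀ {n} (Z : Subset n) → χ (¬? (nonempty? (inside ∷ Z))) ≡ 0
χ-empty-inside Z = χ-no (¬? (nonempty? (inside ∷ Z))) λ empty → empty (zero , here)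

-- The sets counted are the t-subsets of the complement of `X`. Induction along `X` reaches the
-- count without constructing that complement.
∑-disjoint : ∀ {p} (X : Subset p) t →
  ∑ (tSubsets p t) (λ Y → χ (¬? (nonempty? (X ∩ proj₁ Y)))) ≡ (p ℕ.∸ ∣ X ∣) C t
∑-disjoint [] ℕ.zero    = refl
∑-disjoint [] (ℕ.suc t) = sym (k>n⇒nCk≡0 {k = ℕ.suc t} ℕ.z<s)
∑-disjoint {ℕ.suc p} (x ∷ X) ℕ.zero = begin
  ∑ (map addOut (tSubsets p 0)) (λ Y → χ (¬? (nonempty? ((x ∷ X) ∩ proj₁ Y))))
    ≡⟨ ∑-map addOut (tSubsets p 0) _ ⟩
  ∑ (tSubsets p 0) (λ Y → χ (¬? (nonempty? ((x ∷ X) ∩ (outside ∷ proj₁ Y)))))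
    ≡⟨ ∑-cong (tSubsets p 0) (λ Y → without-head x (proj₁ Y)) ⟩
  ∑ (tSubsets p 0) (λ Y → χ (¬? (nonempty? (X ∩ proj₁ Y))))
    ≡⟨ ∑-disjoint X 0 ⟩
  1 ∎
  where
  open ≡-Reasoning
  -- The head of the intersection is `outside` for either `x`, but it computes only once `x` is
  -- known.
  without-head : ∀ x Y → χ (¬? (nonempty? ((x ∷ X) ∩ (outside ∷ Y)))) ≡ χ (¬? (nonempty? (X ∩ Y)))
  without-head outside Y = χ-empty-outside (X ∩ Y)
  without-head inside  Y = χ-empty-outside (X ∩ Y)
∑-disjoint {ℕ.suc p} (x ∷ X) (ℕ.suc t) = begin
  ∑ (map addIn (tSubsets p t) ++ map addOut (tSubsets p (ℕ.suc t))) f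
    ≡⟨ ∑-++ (map addIn (tSubsets p t)) _ f ⟩
  ∑ (map addIn (tSubsets p t)) f ℕ.+ ∑ (map addOut (tSubsets p (ℕ.suc t))) f
    ≡⟨ cong₂ ℕ._+_ (∑-map addIn (tSubsets p t) f) (∑-map addOut (tSubsets p (ℕ.suc t)) f) ⟩
  ∑ (tSubsets p t) (f ∘ addIn) ℕ.+ ∑ (tSubsets p (ℕ.suc t)) (f ∘ addOut)
    ≡⟨ by-head x ⟩
  (ℕ.suc p ℕ.∸ ∣ x ∷ X ∣) C ℕ.suc t ∎
  where
  open ≡-Reasoning
  f : TSubset (ℕ.suc p) (ℕ.suc t) → ℕ
  f Y = χ (¬? (nonempty? ((x ∷ X) ∩ proj₁ Y)))
  by-head : ∀ x →
    ∑ (tSubsets p t) (λ Y → χ (¬? (nonempty? ((x ∷ X) ∩ (inside ∷ proj₁ Y))))) ℕ.+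
    ∑ (tSubsets p (ℕ.suc t)) (λ Y → χ (¬? (nonempty? ((x ∷ X) ∩ (outside ∷ proj₁ Y))))) ≡
    (ℕ.suc p ℕ.∸ ∣ x ∷ X ∣) C ℕ.suc t
  -- Every `Y` that contains the head meets the set, so the first sum is 0. The complement does not
  -- grow: `suc p ∸ suc ∣ X ∣` reduces to `p ∸ ∣ X ∣`.
  by-head inside = cong₂ ℕ._+_
    (trans (∑-constant (tSubsets p t) λ Y → χ-empty-inside (X ∩ proj₁ Y))
           (ℕ.*-zeroʳ (length (tSubsets p t))))
    (trans (∑-cong (tSubsets p (ℕ.suc t)) λ Y → χ-empty-outside (X ∩ proj₁ Y))
           (∑-disjoint X (ℕ.suc t)))
  -- The head now lies in the complement, and `Y` may contain it or not: Pascal's rule on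
  -- `p ∸ ∣ X ∣` points.
  by-head outside = begin
    _ ≡⟨ cong₂ ℕ._+_
           (trans (∑-cong (tSubsets p t) λ Y → χ-empty-outside (X ∩ proj₁ Y))
                  (∑-disjoint X t))
           (trans (∑-cong (tSubsets p (ℕ.suc t)) λ Y → χ-empty-outside (X ∩ proj₁ Y))
                  (∑-disjoint X (ℕ.suc t))) ⟩
    (p ℕ.∸ ∣ X ∣) C t ℕ.+ (p ℕ.∸ ∣ X ∣) C ℕ.suc t
      ≡⟨ nCk+nC[k+1]≡[n+1]C[k+1] (p ℕ.∸ ∣ X ∣) t ⟩
    ℕ.suc (p ℕ.∸ ∣ X ∣) C ℕ.suc t
      -- Truncated subtraction commutes with the successor here because `∣ X ∣` is at most `p`.
      ≡⟨ cong (_C ℕ.suc t) (sym (ℕ.+-∸-assoc 1 (∣p∣≤n X))) ⟩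
    (ℕ.suc p ℕ.∸ ∣ X ∣) C ℕ.suc t ∎

-- Diameter and degrees of the intersection graph

module _ {p t : ℕ} (1<t : 1 ℕ.< t) (t<p : t ℕ.< p) where

  private
    G = Γ p t 1<t t<p

  -- The walks built by `Meets-connected` are short enough: disjoint sets are joined through a t-set
  -- containing a point of each. Repeating its case distinction in `walk-length≤2` makes the length
  -- compute.
  Γ-diameter≤2 : ∀ u v → dist G u v ℕ.≤ 2
  Γ-diameter≤2 u v =
    ℕ.≤-trans (dist-≤ G (proj₂ (Meets-connected 1<t (ℕ.<⇒≤ t<p) u v))) (walk-length≤2 u v)
    where
    walk-length≤2 : ∀ u v → proj₁ (Meets-connected 1<t (ℕ.<⇒≤ t<p) u v) ℕ.≤ 2
    walk-length≤2 u v with u ≟ᵀ v | nonempty? (proj₁ u ∩ proj₁ v)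
    ... | yes refl | _     = ℕ.z≤n
    ... | no _     | yes _ = ℕ.s≤s ℕ.z≤n
    ... | no _     | no _  = ℕ.≤-refl

  -- Every vertex is equal to `u`, adjacent to `u` or disjoint from `u`, and exactly one of these
  -- holds. The disjoint ones are counted by `∑-disjoint`, which sees only the size of `X`.
  Γ-degree : ∀ u → 1 ℕ.+ degree G u ℕ.+ (p ℕ.∸ t) C t ≡ p C t
  Γ-degree u@(X , ∣X∣≡t) = begin
    1 ℕ.+ degree G u ℕ.+ (p ℕ.∸ t) C t
      ≡⟨ cong₂ (λ a b → a ℕ.+ degree G u ℕ.+ b)
           (sym (∑-χ-≟ _≟ᵀ_ (tSubsets-unique p t) (tSubsets-complete p t u)))
           (sym (trans (∑-disjoint X t) (cong (λ s → (p ℕ.∸ s) C t) ∣X∣≡t))) ⟩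
    ∑ Vs equal ℕ.+ ∑ Vs adjacent ℕ.+ ∑ Vs disjoint
      ≡⟨ cong (ℕ._+ ∑ Vs disjoint) (sym (∑-+ Vs equal adjacent)) ⟩
    ∑ Vs (λ v → equal v ℕ.+ adjacent v) ℕ.+ ∑ Vs disjoint
      ≡⟨ sym (∑-+ Vs _ disjoint) ⟩
    ∑ Vs (λ v → equal v ℕ.+ adjacent v ℕ.+ disjoint v)
      ≡⟨ ∑-constant Vs trichotomy ⟩
    length Vs ℕ.* 1
      ≡⟨ trans (ℕ.*-identityʳ _) (length-tSubsets p t) ⟩
    p C t ∎
    where
    open ≡-Reasoning
    Vs = tSubsets p t
    equal adjacent disjoint : TSubset p t → ℕ
    equal v = χ (u ≟ᵀ v)
    adjacent v = χ (meets? u v)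
    disjoint v = χ (¬? (nonempty? (X ∩ proj₁ v)))
    trichotomy : ∀ v → equal v ℕ.+ adjacent v ℕ.+ disjoint v ≡ 1
    trichotomy v with u ≟ᵀ v | nonempty? (X ∩ proj₁ v)
    ... | yes refl | yes _ = refl
    -- A nonempty set meets itself, so being equal excludes being disjoint.
    ... | yes refl | no ¬ne = contradiction
      (subst Nonempty (sym (∩-idem X)) (TSubset-nonempty (ℕ.<⇒≤ 1<t) u)) ¬ne
    ... | no _ | yes _ = refl
    ... | no _ | no _  = refl

-- The embedding of ℕ into ℚ

-- Normalisation of `_/_` blocks computation on variables; among unnormalised rationals all
-- denominators are 1 and the claim is one about integers.
fromℕ-+ : ∀ m n → fromℕ (m ℕ.+ n) ≡ fromℕ m + fromℕ n
fromℕ-+ m n = ℚ.toℚᵘ-injective (begin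
  toℚᵘ (fromℕ (m ℕ.+ n))              ≈⟨ ℚ.toℚᵘ-fromℚᵘ (ℚᵘ.mkℚᵘ (ℤ.+ (m ℕ.+ n)) 0) ⟩
  ℚᵘ.mkℚᵘ (ℤ.+ (m ℕ.+ n)) 0 
    ≈⟨ ℚᵘ.*≡* (cong (ℤ._* ℤ.1ℤ)
         (sym (cong₂ ℤ._+_ (ℤ.*-identityʳ (ℤ.+ m)) (ℤ.*-identityʳ (ℤ.+ n))))) ⟩
  ℚᵘ.mkℚᵘ (ℤ.+ m) 0 ℚᵘ.+ ℚᵘ.mkℚᵘ (ℤ.+ n) 0
    ≈⟨ ℚᵘ.+-cong (ℚ.toℚᵘ-fromℚᵘ (ℚᵘ.mkℚᵘ (ℤ.+ m) 0)) (ℚ.toℚᵘ-fromℚᵘ (ℚᵘ.mkℚᵘ (ℤ.+ n) 0)) ⟨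
  toℚᵘ (fromℕ m) ℚᵘ.+ toℚᵘ (fromℕ n)  ≈⟨ ℚ.toℚᵘ-homo-+ (fromℕ m) (fromℕ n) ⟨
  toℚᵘ (fromℕ m + fromℕ n)            ∎)
  where open ℚᵘ.≃-Reasoning

fromℕ-* : ∀ m n → fromℕ (m ℕ.* n) ≡ fromℕ m * fromℕ n
fromℕ-* ℕ.zero    n = sym (ℚ.*-zeroˡ (fromℕ n))
fromℕ-* (ℕ.suc m) n = begin
  fromℕ (n ℕ.+ m ℕ.* n)              ≡⟨ fromℕ-+ n (m ℕ.* n) ⟩
  fromℕ n + fromℕ (m ℕ.* n)          ≡⟨ cong (fromℕ n +_) (fromℕ-* m n) ⟩
  fromℕ n + fromℕ m * fromℕ n        ≡⟨ cong (_+ fromℕ m * fromℕ n) (sym (ℚ.*-identityˡ (fromℕ n))) ⟩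
  1ℚ * fromℕ n + fromℕ m * fromℕ n   ≡⟨ sym (ℚ.*-distribʳ-+ (fromℕ n) 1ℚ (fromℕ m)) ⟩
  (1ℚ + fromℕ m) * fromℕ n           ≡⟨ cong (_* fromℕ n) (sym (fromℕ-+ 1 m)) ⟩
  fromℕ (ℕ.suc m) * fromℕ n          ∎
  where open ≡-Reasoning

-- Solving the counting relations over ℚ

x≡½*2*x : ∀ x → x ≡ ½ * (fromℕ 2 * x)
x≡½*2*x = solve 1 (λ x → x := con ½ :* (con (fromℕ 2) :* x)) refl
  where open +-*-Solver

-- `N` counts vertices, `M` the vertices disjoint from a given one, `N₂` all pairs, `E` edges and
-- `F` non-edges; `δ` and `σ` are the common degree and status. The relations determine `δ`, `σ`,
-- `E` and `F` from `N`, `M` and `N₂`.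
module _ (N M N₂ δ σ E F : ℚ)
  (1+δ+M≡N : 1ℚ + δ + M ≡ N) (σ+2+δ≡2N : σ + (fromℕ 2 + δ) ≡ N * fromℕ 2)
  (Nδ≡2E : N * δ ≡ fromℕ 2 * E) (E+F≡N₂ : E + F ≡ N₂) (N+2N₂≡NN : N + fromℕ 2 * N₂ ≡ N * N)
  where

  open +-*-Solver
  open ≡-Reasoning

  private
    δ≡ : δ ≡ N - M - 1ℚ
    δ≡ = trans (solve 2 (λ δ M → δ := con 1ℚ :+ δ :+ M :- M :- con 1ℚ) refl δ M)
               (cong (λ n → n - M - 1ℚ) 1+δ+M≡N)

    σ≡ : σ ≡ N + M - 1ℚ
    σ≡ = begin
      σ
        ≡⟨ solve 2 (λ σ δ → σ := σ :+ (con (fromℕ 2) :+ δ) :- (con (fromℕ 2) :+ δ)) refl σ δ ⟩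
      σ + (fromℕ 2 + δ) - (fromℕ 2 + δ)
        ≡⟨ cong₂ (λ a b → a - (fromℕ 2 + b)) σ+2+δ≡2N δ≡ ⟩
      N * fromℕ 2 - (fromℕ 2 + (N - M - 1ℚ))
        ≡⟨ solve 2 (λ N M → N :* con (fromℕ 2) :- (con (fromℕ 2) :+ (N :- M :- con 1ℚ))
                         := N :+ M :- con 1ℚ) refl N M ⟩
      N + M - 1ℚ ∎

    E≡ : E ≡ ½ * N * (N - M - 1ℚ)
    E≡ = begin
      E                        ≡⟨ x≡½*2*x E ⟩
      ½ * (fromℕ 2 * E)        ≡⟨ cong (½ *_) (sym Nδ≡2E) ⟩
      ½ * (N * δ)              ≡⟨ sym (ℚ.*-assoc ½ N δ) ⟩
      ½ * N * δ                ≡⟨ cong (½ * N *_) δ≡ ⟩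
      ½ * N * (N - M - 1ℚ)     ∎

    F≡ : F ≡ N₂ - ½ * N * (N - M - 1ℚ)
    F≡ = begin
      F            ≡⟨ solve 2 (λ E F → F := E :+ F :- E) refl E F ⟩
      E + F - E    ≡⟨ cong₂ _-_ E+F≡N₂ E≡ ⟩
      N₂ - ½ * N * (N - M - 1ℚ) ∎

    N₂≡ : N₂ ≡ ½ * (N * N - N)
    N₂≡ = begin
      N₂                          ≡⟨ solve 2 (λ N N₂ → N₂ := con ½ :* (N :+ con (fromℕ 2) :* N₂ :- N)) refl N N₂ ⟩
      ½ * (N + fromℕ 2 * N₂ - N)  ≡⟨ cong (λ x → ½ * (x - N)) N+2N₂≡NN ⟩
      ½ * (N * N - N)             ∎

  -- With constant status each index is a number of pairs times `σ + σ` or `σ * σ`; substituting the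
  -- solved values leaves polynomial identities.
  index-formulas :
    (E * (σ + σ) ≡ N * (N - M - 1ℚ) * (N + M - 1ℚ)) ×
    (E * (σ * σ) ≡ ½ * N * (N - M - 1ℚ) * (N + M - 1ℚ) ^ 2) ×
    (F * (σ + σ) ≡ M * N * (N + M - 1ℚ)) ×
    (F * (σ * σ) ≡ (N₂ - ½ * N * (N - M - 1ℚ)) * (N + M - 1ℚ) ^ 2)
  index-formulas =
      trans (cong₂ (λ e s → e * (s + s)) E≡ σ≡)
        (solve 3 (λ N d s → con ½ :* N :* d :* (s :+ s) := N :* d :* s)
          refl N (N - M - 1ℚ) (N + M - 1ℚ))
    , trans (cong₂ (λ e s → e * (s * s)) E≡ σ≡) (square (½ * N * (N - M - 1ℚ)))
    , (begin
        -- Only this formula needs `N₂` eliminated: F becomes ½N(N - 1) - ½N(N - M - 1), which is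
        -- ½NM.
        F * (σ + σ)
          ≡⟨ cong₂ (λ f s → f * (s + s)) (trans F≡ (cong (_- ½ * N * (N - M - 1ℚ)) N₂≡)) σ≡ ⟩
        (½ * (N * N - N) - ½ * N * (N - M - 1ℚ)) * ((N + M - 1ℚ) + (N + M - 1ℚ))
          ≡⟨ solve 3 (λ N M s → (con ½ :* (N :* N :- N) :- con ½ :* N :* (N :- M :- con 1ℚ)) :* (s :+ s)
                             := M :* N :* s) refl N M (N + M - 1ℚ) ⟩
        M * N * (N + M - 1ℚ) ∎)
    , trans (cong₂ (λ f s → f * (s * s)) F≡ σ≡) (square (N₂ - ½ * N * (N - M - 1ℚ)))
    where
    square : ∀ x → x * ((N + M - 1ℚ) * (N + M - 1ℚ)) ≡ x * (N + M - 1ℚ) ^ 2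
    -- The right-hand polynomial is the unfolding of `s ^ 2`, including its final factor 1.
    square x = solve 2 (λ x s → x :* (s :* s) := x :* (s :* (s :* con 1ℚ))) refl x (N + M - 1ℚ)

  index-formulas-M≡0 : M ≡ 0ℚ →
    (E * (σ + σ) ≡ N * (N - 1ℚ) ^ 2) ×
    (E * (σ * σ) ≡ ½ * N * (N - 1ℚ) ^ 3) ×
    (F * (σ + σ) ≡ fromℕ 2 * N₂ * (N - 1ℚ) - N * (N - 1ℚ) ^ 2) ×
    (F * (σ * σ) ≡ (N₂ - ½ * N * (N - 1ℚ)) * (N - 1ℚ) ^ 2)
  index-formulas-M≡0 M≡0 = let s₁ , s₂ , _ , s̅₂ = index-formulas in
      trans s₁ (trans (cong₂ (λ d s → N * d * s) N-M-1≡N-1 N+M-1≡N-1)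
        (solve 2 (λ N s → N :* s :* s := N :* (s :* (s :* con 1ℚ))) refl N (N - 1ℚ)))
    , trans s₂ (trans (cong₂ (λ d s → ½ * N * d * s ^ 2) N-M-1≡N-1 N+M-1≡N-1)
        (solve 2 (λ N s → con ½ :* N :* s :* (s :* (s :* con 1ℚ))
          := con ½ :* N :* (s :* (s :* (s :* con 1ℚ)))) refl N (N - 1ℚ)))
    -- The third general formula no longer mentions `N₂`, so this one starts again from `F≡`, where
    -- it is kept.
    , trans (cong₂ (λ f s → f * (s + s)) F≡ (trans σ≡ N+M-1≡N-1))
        (trans (cong (λ d → (N₂ - ½ * N * d) * ((N - 1ℚ) + (N - 1ℚ))) N-M-1≡N-1)
        (solve 3 (λ N N₂ s → (N₂ :- con ½ :* N :* s) :* (s :+ s)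
          := con (fromℕ 2) :* N₂ :* s :- N :* (s :* (s :* con 1ℚ))) refl N N₂ (N - 1ℚ)))
    , trans s̅₂ (cong₂ (λ d s → (N₂ - ½ * N * d) * s ^ 2) N-M-1≡N-1 N+M-1≡N-1)
    where
    N-M-1≡N-1 : N - M - 1ℚ ≡ N - 1ℚ
    N-M-1≡N-1 = cong (_- 1ℚ) (trans (cong (N -_) M≡0) (ℚ.+-identityʳ N))
    N+M-1≡N-1 : N + M - 1ℚ ≡ N - 1ℚ
    N+M-1≡N-1 = cong (_- 1ℚ) (trans (cong (N +_) M≡0) (ℚ.+-identityʳ N))

theorem3p6 :
    (p t : ℕ) (1<t : 1 ℕ.< t) (t<p : t ℕ.< p) →
    let G  = Γ p t 1<t t<p
        N  = fromℕ (p C t)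
        M  = fromℕ ((p ℕ.∸ t) C t)
        N₂ = fromℕ ((p C t) C 2)
    in
    (2 ℕ.* t ℕ.≤ p →
      (fromℕ (S₁ G) ≡ N * (N - M - 1ℚ) * (N + M - 1ℚ)) ×
      (fromℕ (S₂ G) ≡ ½ * N * (N - M - 1ℚ) * (N + M - 1ℚ) ^ 2) ×
      (fromℕ (coS₁ G) ≡ M * N * (N + M - 1ℚ)) ×
      (fromℕ (coS₂ G) ≡ (N₂ - ½ * N * (N - M - 1ℚ)) * (N + M - 1ℚ) ^ 2))
    ×
    (p ℕ.< 2 ℕ.* t →
      (fromℕ (S₁ G) ≡ N * (N - 1ℚ) ^ 2) ×
      (fromℕ (S₂ G) ≡ ½ * N * (N - 1ℚ) ^ 3) ×
      (fromℕ (coS₁ G) ≡ fromℕ 2 * N₂ * (N - 1ℚ) - N * (N - 1ℚ) ^ 2) ×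
      (fromℕ (coS₂ G) ≡ (N₂ - ½ * N * (N - 1ℚ)) * (N - 1ℚ) ^ 2))
theorem3p6 p t 1<t t<p =
    (λ _ → lift (index-formulas N M N₂ δ σ E F 1+δ+M≡N σ+2+δ≡2N Nδ≡2E E+F≡N₂ N+2N₂≡NN))
  -- Two t-subsets of fewer than 2t points always meet: `p ∸ t` is below `t`, so the binomial
  -- coefficient behind `M` vanishes.
  , (λ p<2t → lift (index-formulas-M≡0 N M N₂ δ σ E F 1+δ+M≡N σ+2+δ≡2N Nδ≡2E E+F≡N₂ N+2N₂≡NN
      (cong fromℕ (k>n⇒nCk≡0 (p∸t<t p<2t)))))
  where
  G = Γ p t 1<t t<p
  -- A reference vertex, obtained by enlarging the empty set to size `t`; its degree and status
  -- serve as the common values.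
  u₀ = proj₁ (enlarge ⊥ (subst (ℕ._≤ t) (sym (∣⊥∣≡0 p)) ℕ.z≤n) (ℕ.<⇒≤ t<p))
  N = fromℕ (p C t)
  M = fromℕ ((p ℕ.∸ t) C t)
  N₂ = fromℕ ((p C t) C 2)
  δ = fromℕ (degree G u₀)
  σ = fromℕ (status G u₀)
  E = fromℕ (length (edges G))
  F = fromℕ (length (nonEdges G))

  -- `Γ-degree` equates both sides to `p C t` after the same summands are added, so these cancel.
  degree-constant : ∀ u → degree G u ≡ degree G u₀
  degree-constant u = ℕ.suc-injective (ℕ.+-cancelʳ-≡ ((p ℕ.∸ t) C t) _ _
    (trans (Γ-degree 1<t t<p u) (sym (Γ-degree 1<t t<p u₀))))

  status-constant : ∀ u → status G u ≡ status G u₀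
  status-constant u = ℕ.+-cancelʳ-≡ (2 ℕ.+ degree G u₀) _ _ (begin
    status G u ℕ.+ (2 ℕ.+ degree G u₀)
      ≡⟨ cong (λ d → status G u ℕ.+ (2 ℕ.+ d)) (sym (degree-constant u)) ⟩
    status G u ℕ.+ (2 ℕ.+ degree G u)
      ≡⟨ status+degree G (Γ-diameter≤2 1<t t<p) u ⟩
    length (tSubsets p t) ℕ.* 2
      ≡⟨ sym (status+degree G (Γ-diameter≤2 1<t t<p) u₀) ⟩
    status G u₀ ℕ.+ (2 ℕ.+ degree G u₀) ∎)
    where open ≡-Reasoning

  1+δ+M≡N : 1ℚ + δ + M ≡ N
  1+δ+M≡N = trans (sym (trans (fromℕ-+ (1 ℕ.+ degree G u₀) ((p ℕ.∸ t) C t))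
                              (cong (_+ M) (fromℕ-+ 1 (degree G u₀)))))
                  (cong fromℕ (Γ-degree 1<t t<p u₀))

  σ+2+δ≡2N : σ + (fromℕ 2 + δ) ≡ N * fromℕ 2
  σ+2+δ≡2N = begin
    σ + (fromℕ 2 + δ)                       ≡⟨ cong (σ +_) (sym (fromℕ-+ 2 (degree G u₀))) ⟩
    σ + fromℕ (2 ℕ.+ degree G u₀)           ≡⟨ sym (fromℕ-+ (status G u₀) _) ⟩
    fromℕ (status G u₀ ℕ.+ (2 ℕ.+ degree G u₀))
      ≡⟨ cong fromℕ (status+degree G (Γ-diameter≤2 1<t t<p) u₀) ⟩
    fromℕ (length (tSubsets p t) ℕ.* 2)     ≡⟨ cong (λ n → fromℕ (n ℕ.* 2)) (length-tSubsets p t) ⟩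
    fromℕ ((p C t) ℕ.* 2)                   ≡⟨ fromℕ-* (p C t) 2 ⟩
    N * fromℕ 2                             ∎
    where open ≡-Reasoning

  -- The handshake identity for a regular graph.
  Nδ≡2E : N * δ ≡ fromℕ 2 * E
  Nδ≡2E = begin
    N * δ                                            ≡⟨ sym (fromℕ-* (p C t) (degree G u₀)) ⟩
    fromℕ ((p C t) ℕ.* degree G u₀)
      ≡⟨ cong (λ n → fromℕ (n ℕ.* degree G u₀)) (sym (length-tSubsets p t)) ⟩
    fromℕ (length (tSubsets p t) ℕ.* degree G u₀)
      ≡⟨ cong fromℕ (sym (∑-constant (tSubsets p t) degree-constant)) ⟩
    fromℕ (∑ (tSubsets p t) (degree G))              ≡⟨ cong fromℕ (handshake G) ⟩
    fromℕ (2 ℕ.* length (edges G))                   ≡⟨ fromℕ-* 2 (length (edges G)) ⟩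
    fromℕ 2 * E                                      ∎
    where open ≡-Reasoning

  E+F≡N₂ : E + F ≡ N₂
  E+F≡N₂ = trans (sym (fromℕ-+ (length (edges G)) (length (nonEdges G))))
    (cong fromℕ (trans (∣edges∣+∣nonEdges∣ G) (cong (_C 2) (length-tSubsets p t))))

  N+2N₂≡NN : N + fromℕ 2 * N₂ ≡ N * N
  N+2N₂≡NN = begin
    N + fromℕ 2 * N₂                          ≡⟨ cong (N +_) (sym (fromℕ-* 2 ((p C t) C 2))) ⟩
    N + fromℕ (2 ℕ.* ((p C t) C 2))           ≡⟨ sym (fromℕ-+ (p C t) (2 ℕ.* ((p C t) C 2))) ⟩
    fromℕ (p C t ℕ.+ 2 ℕ.* ((p C t) C 2))     ≡⟨ cong fromℕ (n+2*nC2≡n*n (p C t)) ⟩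
    fromℕ ((p C t) ℕ.* (p C t))               ≡⟨ fromℕ-* (p C t) (p C t) ⟩
    N * N                                     ∎
    where open ≡-Reasoning

  p∸t<t : p ℕ.< 2 ℕ.* t → p ℕ.∸ t ℕ.< t
  -- Subtract `t` on both sides; `2 * t` unfolds to `t + (t + 0)`, hence the identity law for the
  -- remaining 0.
  p∸t<t p<2t = subst (p ℕ.∸ t ℕ.<_) (trans (ℕ.m+n∸m≡n t (t ℕ.+ 0)) (ℕ.+-identityʳ t))
    (ℕ.∸-monoˡ-< p<2t (ℕ.<⇒≤ t<p))

  -- An arbitrary list of pairs, so that edges and non-edges are both covered.
  ∑-status-+ : ∀ ps → fromℕ (∑ ps (λ (u , v) → status G u ℕ.+ status G v)) ≡ fromℕ (length ps) * (σ + σ)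
  ∑-status-+ ps = trans
    (cong fromℕ (∑-constant ps λ (u , v) → cong₂ ℕ._+_ (status-constant u) (status-constant v)))
    (trans (fromℕ-* (length ps) _) (cong (fromℕ (length ps) *_) (fromℕ-+ (status G u₀) (status G u₀))))

  ∑-status-* : ∀ ps → fromℕ (∑ ps (λ (u , v) → status G u ℕ.* status G v)) ≡ fromℕ (length ps) * (σ * σ)
  ∑-status-* ps = trans
    (cong fromℕ (∑-constant ps λ (u , v) → cong₂ ℕ._*_ (status-constant u) (status-constant v)))
    (trans (fromℕ-* (length ps) _) (cong (fromℕ (length ps) *_) (fromℕ-* (status G u₀) (status G u₀))))

  lift : ∀ {a b c d : ℚ} →
    (E * (σ + σ) ≡ a) × (E * (σ * σ) ≡ b) × (F * (σ + σ) ≡ c) × (F * (σ * σ) ≡ d) →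
    (fromℕ (S₁ G) ≡ a) × (fromℕ (S₂ G) ≡ b) × (fromℕ (coS₁ G) ≡ c) × (fromℕ (coS₂ G) ≡ d)
  lift (s₁ , s₂ , s̅₁ , s̅₂) =
      trans (∑-status-+ (edges G)) s₁
    , trans (∑-status-* (edges G)) s₂
    , trans (∑-status-+ (nonEdges G)) s̅₁
    , trans (∑-status-* (nonEdges G)) s̅₂
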